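{- Let $\langle A,\to\rangle$ be a conditional algebra. The correspondence $B\mapsto E_B$ is a dual lattice isomorphism between the lattice of domains of subalgebras of $\langle A,\to\rangle$ (Boolean subalgebras of $A$ closed under $\to$) and the lattice of C-equivalences of the expanded Stone space $\langle\mathrm{Ul}(A),\tau_s,T_A\rangle$.
   Context: A conditional algebra is $\langle A,\to\rangle$ with $A$ a Boolean algebra and $\to$ binary with $a\to1=1$, $(a\to b)\wedge(a\to c)=a\to(b\wedge c)$, $(a\vee b)\to c\le(a\to c)\wedge(b\to c)$. $\mathrm{Ul}(A)$ is the Stone space of ultrafilters; closed sets are the sets $\varphi(F)=\{u:F\subseteq u\}$ for filters $F$ (the improper filter $A$ included). $D^{\to}_u(F)=\{b:\exists a\in F,\ a\to b\in u\}$; $T_A(u,Z,v)$ iff there is a filter $F$ with $Z=\varphi(F)$ and $D^{\to}_u(F)\subseteq v$. $E_B=\{(u,v): u\cap B=v\cap B\}$. For an equivalence $E$ and closed $Y,C$: $Y\preceq_E C$ iff every $y\in Y$ is $E$-related to some $x\in C$. $E$ is a C-equivalence if it is a Boolean equivalence (for each $(x,y)\notin E$ there is a clopen $E$-closed set containing $x$ but not $y$) and whenever $E(x,y)$ and $T_A(x,Y,x')$ with $Y$ closed, there are $y'$ with $E(x',y')$ and closed $C$ with $T_A(y,C,y')$ and $C\preceq_E Y$. -}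

module Defs where

open import Level using (Level; suc; _⊔_)
open import Algebra.Core using (Op₂)
open import Algebra.Definitions using (Congruent₂)
open import Algebra.Lattice.Bundles using (BooleanAlgebra)
import Algebra.Lattice.Bundles as Alg
import Algebra.Lattice.Properties.Lattice as AlgLatticeProperties
open import Algebra.Lattice.Morphism.Structures using (IsLatticeIsomorphism)
open import Data.Product using (Σ-syntax; ∃-syntax; _×_; _,_; proj₁; proj₂)
open import Data.Sum using (inj₁; inj₂; [_,_])
open import Function.Base using (_on_)
open import Relation.Binary.Bundles using (Poset)
open import Relation.Binary.Core using (Rel; _⇒_; _⇔_)
import Relation.Binary.Construct.On as On
open import Relation.Binary.Lattice using (Lattice; IsLattice)
import Relation.Binary.Lattice.Properties.Lattice as OrderLatticeProperties
open import Relation.Binary.Structures using (IsEquivalence)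
open import Relation.Nullary using () renaming (¬_ to Not)
open import Relation.Unary using (Pred; _∈_; _∉_; _⊆_; _≐_; _∩_; _∪_; ∁)
open import Relation.Unary.Relation.Binary.Subset using (⊆-isPartialOrder)

record LatticeStructure {c ℓ₁ ℓ₂} (P : Poset c ℓ₁ ℓ₂) : Set (c ⊔ ℓ₁ ⊔ ℓ₂) where
  open Poset P using (Carrier; _≈_; _≤_)
  field
    _∨_       : Op₂ Carrier
    _∧_       : Op₂ Carrier
    isLattice : IsLattice _≈_ _≤_ _∨_ _∧_

  lattice : Lattice c ℓ₁ ℓ₂
  lattice = record { isLattice = isLattice }

module _ {a ℓ₁ ℓ₂ b ℓ₃ ℓ₄} (L : Lattice a ℓ₁ ℓ₂) (M : Lattice b ℓ₃ ℓ₄) where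

  private
    module L = OrderLatticeProperties L
    module M = OrderLatticeProperties M
    module Mᵒᵖ = OrderLatticeProperties M.∧-∨-lattice

  IsDualLatticeIsomorphism : (Lattice.Carrier L → Lattice.Carrier M) → Set (a ⊔ ℓ₁ ⊔ b ⊔ ℓ₃)
  IsDualLatticeIsomorphism =
    IsLatticeIsomorphism (Alg.Lattice.rawLattice L.algLattice) (Alg.Lattice.rawLattice Mᵒᵖ.algLattice)

record ConditionalAlgebra c ℓ : Set (suc (c ⊔ ℓ)) where
  infixr 5 _⇝_
  field
    booleanAlgebra : BooleanAlgebra c ℓ

  open BooleanAlgebra booleanAlgebra public using (Carrier; _≈_; _∨_; _∧_; ¬_; ⊤; ⊥; lattice)
  open Poset (AlgLatticeProperties.poset lattice) public using (_≤_)

  field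
    _⇝_     : Op₂ Carrier
    ⇝-cong  : Congruent₂ _≈_ _⇝_
    ⇝-⊤     : ∀ a → (a ⇝ ⊤) ≈ ⊤
    ⇝-∧     : ∀ a b c → ((a ⇝ b) ∧ (a ⇝ c)) ≈ (a ⇝ (b ∧ c))
    ∨-⇝     : ∀ a b c → ((a ∨ b) ⇝ c) ≤ ((a ⇝ c) ∧ (b ⇝ c))

-- All subsets of the algebra, all sets of ultrafilters and all relations
-- between ultrafilters are taken at the single level c ⊔ ℓ.  Equality of
-- subsets is extensional equality _≐_.

module _ {c ℓ} (𝔸 : ConditionalAlgebra c ℓ) where

  open ConditionalAlgebra 𝔸

  private
    s : Level
    s = c ⊔ ℓ

  -- The improper filter is allowed.
  record IsFilter (F : Pred Carrier s) : Set s where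
    field
      ⊤-mem    : ⊤ ∈ F
      ∧-closed : ∀ {a b} → a ∈ F → b ∈ F → (a ∧ b) ∈ F
      ≤-closed : ∀ {a b} → a ∈ F → a ≤ b → b ∈ F

  record IsUltrafilter (u : Pred Carrier s) : Set (suc s) where
    field
      isFilter : IsFilter u
      proper   : ⊥ ∉ u
      maximal  : ∀ (G : Pred Carrier s) → IsFilter G → ⊥ ∉ G → u ⊆ G → G ⊆ u

  record Ul : Set (suc s) where
    field
      set           : Pred Carrier s
      isUltrafilter : IsUltrafilter set

  open Ul using (set)

  _≋_ : Rel Ul s
  u ≋ v = set u ≐ set v

  φ : Pred Carrier s → Pred Ul s
  φ F u = F ⊆ set u

  IsClosed : Pred Ul s → Set (suc s)
  IsClosed Z = ∃[ F ] IsFilter F × Z ≐ φ F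

  IsClopen : Pred Ul s → Set (suc s)
  IsClopen U = IsClosed U × IsClosed (∁ U)

  D : Ul → Pred Carrier s → Pred Carrier s
  D u F b = ∃[ a ] a ∈ F × (a ⇝ b) ∈ set u

  T : Ul → Pred Ul s → Ul → Set (suc s)
  T u Z v = ∃[ F ] IsFilter F × Z ≐ φ F × D u F ⊆ set v

  Dominated : Rel Ul s → Pred Ul s → Pred Ul s → Set (suc s)
  Dominated E Y C = ∀ {y} → y ∈ Y → ∃[ x ] x ∈ C × E y x

  syntax Dominated E Y C = Y ≼[ E ] C

  -- "E-closed": a union of E-classes; no topological content.
  _IsSaturatedUnder_ : Pred Ul s → Rel Ul s → Set (suc s)
  U IsSaturatedUnder E = ∀ {x y} → E x y → x ∈ U → y ∈ U

  record IsBooleanEquivalence (E : Rel Ul s) : Set (suc s) where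
    field
      isEquivalence : IsEquivalence E
      -- E is a relation on the points of the space, i.e. on ultrafilters up to _≋_.
      reflexive     : _≋_ ⇒ E
      separated     : ∀ {x y} → Not (E x y) →
                      Σ[ U ∈ Pred Ul s ] IsClopen U × U IsSaturatedUnder E × x ∈ U × y ∉ U

  record IsCEquivalence (E : Rel Ul s) : Set (suc s) where
    field
      isBooleanEquivalence : IsBooleanEquivalence E
      back : ∀ {x y x′} {Y : Pred Ul s} → E x y → IsClosed Y → T x Y x′ →
             Σ[ y′ ∈ Ul ] E x′ y′ × (Σ[ C ∈ Pred Ul s ] IsClosed C × T y C y′ × C ≼[ E ] Y)

  record CEquivalence : Set (suc s) where
    constructor mkCEquivalence
    field
      rel            : Rel Ul s
      isCEquivalence : IsCEquivalence rel

  cEquivalencePoset : Poset (suc s) (suc s) (suc s)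
  cEquivalencePoset = record
    { Carrier        = CEquivalence
    ; _≈_            = λ E E′ → rel E ⇔ rel E′
    ; _≤_            = λ E E′ → rel E ⇒ rel E′
    ; isPartialOrder = record
      { isPreorder = record
        { isEquivalence = record
          { refl  = (λ e → e) , (λ e → e)
          ; sym   = λ (p , q) → q , p
          ; trans = λ (p , q) (p′ , q′) → (λ e → p′ (p e)) , (λ e → q (q′ e))
          }
        ; reflexive = proj₁
        ; trans     = λ p q e → q (p e)
        }
      ; antisym = λ p q → p , q
      }
    }
    where open CEquivalence

  record IsSubalgebra (B : Pred Carrier s) : Set s where
    field
      ≈-closed : ∀ {a b} → a ≈ b → a ∈ B → b ∈ B
      ⊤-mem    : ⊤ ∈ B
      ⊥-mem    : ⊥ ∈ B
      ¬-closed : ∀ {a} → a ∈ B → (¬ a) ∈ B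
      ∧-closed : ∀ {a b} → a ∈ B → b ∈ B → (a ∧ b) ∈ B
      ∨-closed : ∀ {a b} → a ∈ B → b ∈ B → (a ∨ b) ∈ B
      ⇝-closed : ∀ {a b} → a ∈ B → b ∈ B → (a ⇝ b) ∈ B

  record Subalgebra : Set (suc s) where
    field
      domain       : Pred Carrier s
      isSubalgebra : IsSubalgebra domain

  open Subalgebra using (domain)

  data Generated (X : Pred Carrier s) : Pred Carrier s where
    gen      : ∀ {a} → a ∈ X → Generated X a
    ≈-closed : ∀ {a b} → a ≈ b → Generated X a → Generated X b
    ⊤-mem    : Generated X ⊤
    ⊥-mem    : Generated X ⊥
    ¬-closed : ∀ {a} → Generated X a → Generated X (¬ a)
    ∧-closed : ∀ {a b} → Generated X a → Generated X b → Generated X (a ∧ b)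
    ∨-closed : ∀ {a b} → Generated X a → Generated X b → Generated X (a ∨ b)
    ⇝-closed : ∀ {a b} → Generated X a → Generated X b → Generated X (a ⇝ b)

  Generated-least : ∀ {X B} → IsSubalgebra B → X ⊆ B → Generated X ⊆ B
  Generated-least {X} {B} isB X⊆B = go
    where
    module B = IsSubalgebra isB
    go : Generated X ⊆ B
    go (gen p)        = X⊆B p
    go (≈-closed e p) = B.≈-closed e (go p)
    go ⊤-mem          = B.⊤-mem
    go ⊥-mem          = B.⊥-mem
    go (¬-closed p)   = B.¬-closed (go p)
    go (∧-closed p q) = B.∧-closed (go p) (go q)
    go (∨-closed p q) = B.∨-closed (go p) (go q)
    go (⇝-closed p q) = B.⇝-closed (go p) (go q)

  ⟨_⟩ : Pred Carrier s → Subalgebra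
  ⟨ X ⟩ = record
    { domain       = Generated X
    ; isSubalgebra = record
      { ≈-closed = ≈-closed ; ⊤-mem = ⊤-mem ; ⊥-mem = ⊥-mem ; ¬-closed = ¬-closed
      ; ∧-closed = ∧-closed ; ∨-closed = ∨-closed ; ⇝-closed = ⇝-closed
      }
    }

  _⊓_ : Op₂ Subalgebra
  B ⊓ C = record
    { domain       = domain B ∩ domain C
    ; isSubalgebra = record
      { ≈-closed = λ e (p , q) → B.≈-closed e p , C.≈-closed e q
      ; ⊤-mem    = B.⊤-mem , C.⊤-mem
      ; ⊥-mem    = B.⊥-mem , C.⊥-mem
      ; ¬-closed = λ (p , q) → B.¬-closed p , C.¬-closed q
      ; ∧-closed = λ (p , q) (p′ , q′) → B.∧-closed p p′ , C.∧-closed q q′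
      ; ∨-closed = λ (p , q) (p′ , q′) → B.∨-closed p p′ , C.∨-closed q q′
      ; ⇝-closed = λ (p , q) (p′ , q′) → B.⇝-closed p p′ , C.⇝-closed q q′
      }
    }
    where
    module B = IsSubalgebra (Subalgebra.isSubalgebra B)
    module C = IsSubalgebra (Subalgebra.isSubalgebra C)

  subalgebraLattice : Lattice (suc s) s s
  subalgebraLattice = record
    { Carrier   = Subalgebra
    ; _≈_       = _≐_ on domain
    ; _≤_       = λ B C → domain B ⊆ domain C
    ; _∨_       = λ B C → ⟨ domain B ∪ domain C ⟩
    ; _∧_       = _⊓_
    ; isLattice = record
      { isPartialOrder = On.isPartialOrder domain ⊆-isPartialOrder
      ; supremum       = λ B C →
          (λ p → gen (inj₁ p)) , (λ p → gen (inj₂ p)) ,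
          λ D B⊆D C⊆D → Generated-least (Subalgebra.isSubalgebra D) [ B⊆D , C⊆D ]
      ; infimum        = λ B C → proj₁ , proj₂ , λ D D⊆B D⊆C p → D⊆B p , D⊆C p
      }
    }

  E[_] : Subalgebra → Rel Ul s
  E[ B ] u v = (set u ∩ domain B) ≐ (set v ∩ domain B)

{-# OPTIONS --safe #-}
module Submission where

-- A C-equivalence E is recovered from the algebra of all a whose clopen set φ(a) is
-- E-saturated, so B ↦ E_B is an order anti-isomorphism and the lattice structure transports.
-- Everything rests on one extension lemma: if G is a filter whose elements in B all lie in
-- the ultrafilter z, then some ultrafilter contains G and agrees with z on B.  It yields the
-- back condition for E_B (applied to F and to D_y of the filter generated by F ∩ B)
-- and also separates an element outside B by two E_B-related ultrafilters.
-- Ultrafilters come from Zorn's lemma, proved by Zermelo's towers on Bool-valued subsets,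
-- where extensionality makes the chosen successor a function of the subset.

open import Defs
open import Algebra.Lattice.Bundles using (BooleanAlgebra)
import Algebra.Lattice.Bundles as AlgLattice
import Algebra.Lattice.Properties.BooleanAlgebra as BooleanAlgebraProperties
import Algebra.Lattice.Properties.Lattice as AlgLatticeProperties
open import Axiom.DoubleNegationElimination using (DoubleNegationElimination; em⇒dne)
open import Axiom.ExcludedMiddle using (ExcludedMiddle)
open import Axiom.Extensionality.Propositional using (Extensionality)
open import Data.Bool using (Bool; true)
open import Data.Bool.Properties using (⇔→≡)
open import Data.Product using (Σ-syntax; ∃-syntax; _×_; _,_; proj₁; proj₂)
open import Data.Sum using (_⊎_; inj₁; inj₂)
import Data.Sum as Sum
open import Function.Base using (_∘_; id)
open import Function.Bundles using (mk⇔)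
open import Level using (Level; Lift; lift; lower; _⊔_)
open import Relation.Binary.Bundles using (Poset)
import Relation.Binary.Lattice as Order
import Relation.Binary.Lattice.Properties.Lattice as OrderLatticeProperties
open import Relation.Binary.Structures using (IsEquivalence)
open import Relation.Binary.PropositionalEquality using (_≡_; refl; subst)
open import Relation.Nullary using (Dec; does; yes; no; contradiction) renaming (¬_ to Not)
open import Relation.Unary using (Pred; _∈_; _∉_; _⊆_; _≐_)

-- Classical logic on subsets: decisions, resizing and unions.

module Classical (em : ∀ {p} → ExcludedMiddle p) (ext : ∀ {a b} → Extensionality a b) where

  abstract
    dne : ∀ {p} → DoubleNegationElimination p
    dne = em⇒dne em

  decide : ∀ {p} → Set p → Bool
  decide P = does (em {P = P})

  decide-sound : ∀ {p} {P : Set p} → decide P ≡ true → P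
  decide-sound {P = P} eq with em {P = P}
  ... | yes p = p
  decide-sound {P = P} () | no _

  decide-complete : ∀ {p} {P : Set p} → P → decide P ≡ true
  decide-complete {P = P} p with em {P = P}
  ... | yes _ = refl
  ... | no ¬p = contradiction p ¬p

  -- Excluded middle gives propositional resizing: quantifying over all ultrafilters
  -- still defines a subset of the algebra at the level c ⊔ ℓ.
  Resize : ∀ {p} r → Set p → Set r
  Resize r P = Lift r (decide P ≡ true)

  resize : ∀ {p r} {P : Set p} → P → Resize r P
  resize p = lift (decide-complete p)

  unresize : ∀ {p r} {P : Set p} → Resize r P → P
  unresize q = decide-sound (lower q)

  module _ {a} {A : Set a} where

    Subset : Set a
    Subset = A → Bool

    infix 4 _⊑_
    _⊑_ : Subset → Subset → Set a
    X ⊑ Y = ∀ {x} → X x ≡ true → Y x ≡ true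

    ⊑-antisym : ∀ {X Y} → X ⊑ Y → Y ⊑ X → X ≡ Y
    ⊑-antisym p q = ext λ _ → ⇔→≡ (mk⇔ p q)

    ⋃ : (Subset → Bool) → Subset
    ⋃ S x = decide (∃[ X ] S X ≡ true × X x ≡ true)

    ⋃-upper : ∀ {S X} → S X ≡ true → X ⊑ ⋃ S
    ⋃-upper X∈S x∈X = decide-complete (_ , X∈S , x∈X)

    ⋃-least : ∀ {S Y} → (∀ {X} → S X ≡ true → X ⊑ Y) → ⋃ S ⊑ Y
    ⋃-least S⊑Y x∈⋃ with decide-sound x∈⋃
    ... | _ , X∈S , x∈X = S⊑Y X∈S x∈X

    IsChain : (Subset → Bool) → Set a
    IsChain S = ∀ {X Y} → S X ≡ true → S Y ≡ true → X ⊑ Y ⊎ Y ⊑ X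

  -- Zorn's lemma for families of subsets.

  module Zorn {a p} {A : Set a} (Good : (A → Bool) → Set p)
    (⋃-good : ∀ S → IsChain S → (∃[ X ] S X ≡ true) → (∀ {X} → S X ≡ true → Good X) → Good (⋃ S))
    {X₀ : A → Bool} (X₀-good : Good X₀) where

    Extension : (A → Bool) → Set (a ⊔ p)
    Extension X = ∃[ Y ] Good Y × X ⊑ Y × Not (Y ⊑ X)

    extendBy : ∀ X → Dec (Extension X) → A → Bool
    extendBy X (yes (Y , _)) = Y
    extendBy X (no _)        = X

    -- Excluded middle on the Σ-type `Extension X` returns an actual larger good set when there is
    -- one, so it serves as the choice function.
    next : (A → Bool) → A → Bool
    next X = extendBy X em

    next-good : ∀ {X} → Good X → Good (next X)
    next-good {X} good with em {P = Extension X}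
    ... | yes (_ , goodY , _) = goodY
    ... | no _                = good

    next-inflationary : ∀ {X} → X ⊑ next X
    next-inflationary {X} with em {P = Extension X}
    ... | yes (_ , _ , X⊑Y , _) = X⊑Y
    ... | no _                  = id

    next-fixed : ∀ {X} → next X ⊑ X → Not (Extension X)
    next-fixed {X} fixed with em {P = Extension X}
    ... | yes (_ , _ , _ , Y⋢X) = contradiction (λ {x} → fixed {x}) Y⋢X
    ... | no ¬ext               = ¬ext

    -- The smallest family containing `X₀` and closed under `next` and nonempty unions. Families are
    -- `Bool`-valued, so that the union of all tower sets is itself an instance of `sup`.
    data Tower : (A → Bool) → Set a where
      base : Tower X₀
      step : ∀ {X} → Tower X → Tower (next X)
      sup  : ∀ S → ∃[ X ] S X ≡ true → (∀ {X} → S X ≡ true → Tower X) → Tower (⋃ S)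

    base⊑ : ∀ {X} → Tower X → X₀ ⊑ X
    base⊑ base                  p = p
    base⊑ (step t)              p = next-inflationary (base⊑ t p)
    base⊑ (sup S (X , X∈S) all) p = ⋃-upper X∈S (base⊑ (all X∈S) p)

    -- Stronger than comparability: `Y` does not fall strictly between `X` and `next X`. This form
    -- is what passes through successor steps.
    _≺_ : (A → Bool) → (A → Bool) → Set a
    X ≺ Y = next X ⊑ Y ⊎ Y ⊑ X

    -- In the last case X and Y are equal, which is where extensionality enters.
    ≺-step : ∀ {X Y} → X ≺ Y → Y ≺ X → X ≺ next Y
    ≺-step (inj₁ gX⊑Y) _          = inj₁ (λ p → next-inflationary (gX⊑Y p))
    ≺-step (inj₂ Y⊑X) (inj₁ gY⊑X) = inj₂ gY⊑X
    ≺-step {X} {Y} (inj₂ Y⊑X) (inj₂ X⊑Y) =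
      inj₁ (subst (λ Z → next X ⊑ next Z) (⊑-antisym X⊑Y Y⊑X) id)

    ≺-sup : ∀ {X} S → (∀ {Y} → S Y ≡ true → X ≺ Y) → X ≺ ⋃ S
    ≺-sup {X} S X≺S with em {P = ∃[ Y ] S Y ≡ true × next X ⊑ Y}
    ... | yes (_ , Y∈S , gX⊑Y) = inj₁ (λ p → ⋃-upper Y∈S (gX⊑Y p))
    ... | no ¬gX⊑ = inj₂ (⋃-least below)
      where
      below : ∀ {Y} → S Y ≡ true → Y ⊑ X
      below Y∈S with X≺S Y∈S
      ... | inj₁ gX⊑Y = contradiction (_ , Y∈S , λ {x} → gX⊑Y {x}) ¬gX⊑
      ... | inj₂ Y⊑X  = Y⊑X

    ≺-flip : ∀ {X} → Tower X → (∀ {Z} → Tower Z → Z ≺ X) → ∀ {Y} → Tower Y → X ≺ Y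
    ≺-flip tX all≺X base          = inj₂ (base⊑ tX)
    ≺-flip tX all≺X (step t)      = ≺-step (≺-flip tX all≺X t) (all≺X t)
    ≺-flip tX all≺X (sup S _ all) = ≺-sup S (λ Y∈S → ≺-flip tX all≺X (all Y∈S))

    -- Induction on `Y` with `X` arbitrary. At a successor, `≺-step` also needs the reverse relation
    -- `Y ≺ X`; the induction hypothesis for all `X` at once gives it through `≺-flip`.
    ≺-total : ∀ {X Y} → Tower Y → Tower X → X ≺ Y
    ≺-total base          tX = inj₂ (base⊑ tX)
    ≺-total (step t)      tX = ≺-step (≺-total t tX) (≺-flip t (≺-total t) tX)
    ≺-total (sup S _ all) tX = ≺-sup S (λ Y∈S → ≺-total (all Y∈S) tX)

    tower-comparable : ∀ {X Y} → Tower X → Tower Y → X ⊑ Y ⊎ Y ⊑ X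
    tower-comparable tX tY = Sum.map₁ (λ gX⊑Y {_} p → gX⊑Y (next-inflationary p)) (≺-total tY tX)

    tower-good : ∀ {X} → Tower X → Good X
    tower-good base            = X₀-good
    tower-good (step t)        = next-good (tower-good t)
    tower-good (sup S inh all) =
      ⋃-good S (λ p q → tower-comparable (all p) (all q)) inh (λ p → tower-good (all p))

    top : A → Bool
    top = ⋃ (λ X → decide (Tower X))

    top-tower : Tower top
    top-tower = sup _ (X₀ , decide-complete base) decide-sound

    zorn : ∃[ M ] Good M × X₀ ⊑ M × (∀ {Y} → Good Y → M ⊑ Y → Y ⊑ M)
    zorn = top , tower-good top-tower , base⊑ top-tower , maximal
      where
      -- `next top` is again a tower set, hence one of the sets united in `top`.
      fixed : next top ⊑ top
      fixed = ⋃-upper (decide-complete (step top-tower))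

      maximal : ∀ {Y} → Good Y → top ⊑ Y → Y ⊑ top
      maximal goodY top⊑Y = dne λ Y⋢top → next-fixed fixed (_ , goodY , top⊑Y , Y⋢top)

module Duality (em : ∀ {p} → ExcludedMiddle p) (ext : ∀ {a b} → Extensionality a b)
  {c ℓ} (𝔸 : ConditionalAlgebra c ℓ) where

  open Classical em ext
  open ConditionalAlgebra 𝔸
  open BooleanAlgebra booleanAlgebra
    using (∨-complementˡ; ∨-complementʳ; ∧-complementʳ; ∧-distribˡ-∨)
    renaming (refl to ≈-refl; sym to ≈-sym; trans to ≈-trans)
  open BooleanAlgebraProperties booleanAlgebra
    using (∧-identityʳ; ∧-zeroˡ; deMorgan₂)
  open Order.Lattice (AlgLatticeProperties.∨-∧-orderTheoreticLattice lattice)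
    using (antisym; x≤x∨y; y≤x∨y; ∨-least; x∧y≤x; x∧y≤y; ∧-greatest)
    renaming (refl to ≤-refl; reflexive to ≤-reflexive; trans to ≤-trans)

  open Ul using (set; isUltrafilter)
  open Subalgebra using (domain; isSubalgebra)
  open CEquivalence using (rel; isCEquivalence)
  open IsFilter renaming (⊤-mem to filter-⊤; ∧-closed to filter-∧; ≤-closed to filter-≤)

  private
    s : Level
    s = c ⊔ ℓ

  -- Order facts in the conditional algebra.

  x≤⊤ : ∀ {x} → x ≤ ⊤
  x≤⊤ = ≈-sym (∧-identityʳ _)

  ⊥≤x : ∀ {x} → ⊥ ≤ x
  ⊥≤x = ≈-sym (∧-zeroˡ _)

  ∧-mono : ∀ {w x y z} → w ≤ x → y ≤ z → (w ∧ y) ≤ (x ∧ z)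
  ∧-mono w≤x y≤z = ∧-greatest (≤-trans (x∧y≤x _ _) w≤x) (≤-trans (x∧y≤y _ _) y≤z)

  -- `x` is the join of `x ∧ y` and `x ∧ z`. This turns a contradiction from adjoining an element to
  -- a filter into membership of its complement.
  disjoint⇒≤ : ∀ {x y z} → (y ∨ z) ≈ ⊤ → (x ∧ y) ≤ ⊥ → x ≤ z
  disjoint⇒≤ {x} {y} {z} y∨z≈⊤ x∧y≤⊥ =
    ≤-trans (∧-greatest ≤-refl (≤-trans x≤⊤ (≤-reflexive (≈-sym y∨z≈⊤))))
      (≤-trans (≤-reflexive (∧-distribˡ-∨ x y z)) (∨-least (≤-trans x∧y≤⊥ ⊥≤x) (x∧y≤y x z)))

  ⇝-monoʳ : ∀ {a b d} → b ≤ d → (a ⇝ b) ≤ (a ⇝ d)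
  -- `b ≤ d` is by definition the equation `b ≈ b ∧ d`.
  ⇝-monoʳ {a} {b} {d} b≤d = ≈-trans (⇝-cong ≈-refl b≤d) (≈-sym (⇝-∧ a b d))

  ⇝-antitoneˡ : ∀ {a b d} → a ≤ b → (b ⇝ d) ≤ (a ⇝ d)
  ⇝-antitoneˡ {a} {b} {d} a≤b =
    ≤-trans (≤-reflexive (⇝-cong b≈a∨b ≈-refl)) (≤-trans (∨-⇝ a b d) (x∧y≤x _ _))
    where
    b≈a∨b : b ≈ (a ∨ b)
    b≈a∨b = antisym (y≤x∨y a b) (∨-least a≤b ≤-refl)

  -- Filters

  ↑_ : Carrier → Pred Carrier s
  (↑ a) x = Lift s (a ≤ x)

  ↑-isFilter : ∀ a → IsFilter 𝔸 (↑ a)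
  ↑-isFilter a = record
    { ⊤-mem    = lift x≤⊤
    ; ∧-closed = λ (lift p) (lift q) → lift (∧-greatest p q)
    ; ≤-closed = λ (lift p) q → lift (≤-trans p q)
    }

  -- For filters `F` and `G`, the filter generated by their union.
  _⊻_ : Pred Carrier s → Pred Carrier s → Pred Carrier s
  (F ⊻ G) x = ∃[ f ] ∃[ g ] f ∈ F × g ∈ G × Lift s ((f ∧ g) ≤ x)

  ∧-interchange-≤ : ∀ {f g f′ g′} → ((f ∧ f′) ∧ (g ∧ g′)) ≤ ((f ∧ g) ∧ (f′ ∧ g′))
  ∧-interchange-≤ = ∧-greatest (∧-mono (x∧y≤x _ _) (x∧y≤x _ _)) (∧-mono (x∧y≤y _ _) (x∧y≤y _ _))

  ⊻-isFilter : ∀ {F G} → IsFilter 𝔸 F → IsFilter 𝔸 G → IsFilter 𝔸 (F ⊻ G)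
  ⊻-isFilter isF isG = record
    { ⊤-mem    = ⊤ , ⊤ , filter-⊤ isF , filter-⊤ isG , lift x≤⊤
    ; ∧-closed = λ (f , g , f∈F , g∈G , lift p) (f′ , g′ , f′∈F , g′∈G , lift p′) →
        f ∧ f′ , g ∧ g′ , filter-∧ isF f∈F f′∈F , filter-∧ isG g∈G g′∈G ,
        lift (≤-trans ∧-interchange-≤ (∧-mono p p′))
    ; ≤-closed = λ (f , g , f∈F , g∈G , lift p) q → f , g , f∈F , g∈G , lift (≤-trans p q)
    }

  ⊻-upperˡ : ∀ {F G} → IsFilter 𝔸 G → F ⊆ (F ⊻ G)
  ⊻-upperˡ isG f∈F = _ , ⊤ , f∈F , filter-⊤ isG , lift (x∧y≤x _ _)

  ⊻-upperʳ : ∀ {F G} → IsFilter 𝔸 F → G ⊆ (F ⊻ G)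
  ⊻-upperʳ isF g∈G = ⊤ , _ , filter-⊤ isF , g∈G , lift (x∧y≤y _ _)

  -- For a filter `F`, the filter generated by `F ∩ domain B`.
  _↾_ : Pred Carrier s → Subalgebra 𝔸 → Pred Carrier s
  (F ↾ B) x = ∃[ b ] b ∈ F × b ∈ domain B × Lift s (b ≤ x)

  ↾-isFilter : ∀ {F} → IsFilter 𝔸 F → ∀ B → IsFilter 𝔸 (F ↾ B)
  ↾-isFilter isF B = record
    { ⊤-mem    = ⊤ , filter-⊤ isF , B.⊤-mem , lift ≤-refl
    ; ∧-closed = λ (b , b∈F , b∈B , lift p) (b′ , b′∈F , b′∈B , lift p′) →
        b ∧ b′ , filter-∧ isF b∈F b′∈F , B.∧-closed b∈B b′∈B , lift (∧-mono p p′)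
    ; ≤-closed = λ (b , b∈F , b∈B , lift p) q → b , b∈F , b∈B , lift (≤-trans p q)
    }
    where module B = IsSubalgebra (isSubalgebra B)

  ≈-mem : ∀ {F a b} → IsFilter 𝔸 F → a ≈ b → a ∈ F → b ∈ F
  ≈-mem isF a≈b a∈F = filter-≤ isF a∈F (≤-reflexive a≈b)

  -- Ultrafilters

  ul-filter : (u : Ul 𝔸) → IsFilter 𝔸 (set u)
  ul-filter u = IsUltrafilter.isFilter (isUltrafilter u)

  ul-consistent : (u : Ul 𝔸) → ∀ {a b} → a ∈ set u → b ∈ set u → Not ((a ∧ b) ≤ ⊥)
  ul-consistent u a∈u b∈u a∧b≤⊥ =
    IsUltrafilter.proper (isUltrafilter u)
      (filter-≤ (ul-filter u) (filter-∧ (ul-filter u) a∈u b∈u) a∧b≤⊥)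

  ul-¬ : (u : Ul 𝔸) → ∀ {a} → a ∈ set u → (¬ a) ∉ set u
  ul-¬ u a∈u ¬a∈u = ul-consistent u a∈u ¬a∈u (≤-reflexive (∧-complementʳ _))

  -- If `¬ a` were missing too, the filter generated by `u` and `a` would be proper, and maximality
  -- would put `a` into `u`.
  ul-complete : (u : Ul 𝔸) → ∀ {a} → a ∉ set u → (¬ a) ∈ set u
  ul-complete u {a} a∉u = dne λ ¬a∉u →
    a∉u (IsUltrafilter.maximal (isUltrafilter u) (set u ⊻ (↑ a))
      (⊻-isFilter (ul-filter u) (↑-isFilter a))
      (λ (f , g , f∈u , lift a≤g , lift f∧g≤⊥) → ¬a∉u (filter-≤ (ul-filter u) f∈u
        (disjoint⇒≤ (∨-complementʳ a) (≤-trans (∧-mono ≤-refl a≤g) f∧g≤⊥))))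
      (⊻-upperˡ (↑-isFilter a))
      (⊻-upperʳ (ul-filter u) (lift ≤-refl)))

  ul-∨ : (u : Ul 𝔸) → ∀ {a b} → (a ∨ b) ∈ set u → Not (a ∉ set u × b ∉ set u)
  ul-∨ u a∨b∈u (a∉u , b∉u) =
    ul-¬ u a∨b∈u (≈-mem (ul-filter u) (≈-sym (deMorgan₂ _ _))
      (filter-∧ (ul-filter u) (ul-complete u a∉u) (ul-complete u b∉u)))

  ⟦_⟧ : (Carrier → Bool) → Pred Carrier s
  ⟦ X ⟧ a = Lift s (X a ≡ true)

  Proper : (Carrier → Bool) → Set s
  Proper X = IsFilter 𝔸 ⟦ X ⟧ × ⊥ ∉ ⟦ X ⟧

  ⋃-proper : ∀ S → IsChain S → (∃[ X ] S X ≡ true) → (∀ {X} → S X ≡ true → Proper X) → Proper (⋃ S)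
  ⋃-proper S chain (X₀ , X₀∈S) proper = isF , ⊥∉
    where
    isF : IsFilter 𝔸 ⟦ ⋃ S ⟧
    isF .filter-⊤ = lift (⋃-upper X₀∈S (lower (filter-⊤ (proj₁ (proper X₀∈S)))))
    isF .filter-∧ (lift a∈⋃) (lift b∈⋃) with decide-sound a∈⋃ | decide-sound b∈⋃
    ... | X , X∈S , a∈X | Y , Y∈S , b∈Y with chain X∈S Y∈S
    ...   | inj₁ X⊑Y = lift (⋃-upper Y∈S (lower
                         (filter-∧ (proj₁ (proper Y∈S)) (lift (X⊑Y a∈X)) (lift b∈Y))))
    ...   | inj₂ Y⊑X = lift (⋃-upper X∈S (lower
                         (filter-∧ (proj₁ (proper X∈S)) (lift a∈X) (lift (Y⊑X b∈Y)))))
    isF .filter-≤ (lift a∈⋃) a≤b with decide-sound a∈⋃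
    ... | X , X∈S , a∈X = lift (⋃-upper X∈S (lower (filter-≤ (proj₁ (proper X∈S)) (lift a∈X) a≤b)))

    ⊥∉ : ⊥ ∉ ⟦ ⋃ S ⟧
    ⊥∉ (lift ⊥∈⋃) with decide-sound ⊥∈⋃
    ... | X , X∈S , ⊥∈X = proj₂ (proper X∈S) (lift ⊥∈X)

  ⌊_⌋ : Pred Carrier s → Carrier → Bool
  ⌊ F ⌋ a = decide (F a)

  ⌊⌋-proper : ∀ {F} → IsFilter 𝔸 F → ⊥ ∉ F → Proper ⌊ F ⌋
  ⌊⌋-proper isF ⊥∉F = record
    { ⊤-mem    = resize (filter-⊤ isF)
    ; ∧-closed = λ p q → resize (filter-∧ isF (unresize p) (unresize q))
    ; ≤-closed = λ p q → resize (filter-≤ isF (unresize p) q)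
    } , λ p → ⊥∉F (unresize p)

  abstract
    -- Zorn's lemma on proper filters coded as `Bool`-valued subsets. A competing filter `G` given
    -- as a predicate is coded by `⌊ G ⌋`, so maximality among codes suffices.
    ultrafilter-extension : ∀ {F} → IsFilter 𝔸 F → ⊥ ∉ F → Σ[ u ∈ Ul 𝔸 ] F ⊆ set u
    ultrafilter-extension isF ⊥∉F with Zorn.zorn Proper ⋃-proper (⌊⌋-proper isF ⊥∉F)
    ... | M , (isM , ⊥∉M) , F⊑M , maximal = record
      { set           = ⟦ M ⟧
      ; isUltrafilter = record
        { isFilter = isM
        ; proper   = ⊥∉M
        ; maximal  = λ G isG ⊥∉G M⊆G {x} x∈G → lift
            (maximal (⌊⌋-proper isG ⊥∉G) (λ p → decide-complete (M⊆G (lift p))) (decide-complete x∈G))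
        }
      } , λ a∈F → lift (F⊑M (decide-complete a∈F))

  -- `F` together with `¬ a` generates a proper filter, since `f ∧ ¬ a ≤ ⊥` would give `f ≤ a`.
  ultrafilter-separation : ∀ {F a} → IsFilter 𝔸 F → a ∉ F → Σ[ u ∈ Ul 𝔸 ] F ⊆ set u × a ∉ set u
  ultrafilter-separation {F} {a} isF a∉F =
    let u , ⊆u = ultrafilter-extension (⊻-isFilter isF (↑-isFilter (¬ a))) ⊥∉ in
    u , (λ f∈F → ⊆u (⊻-upperˡ (↑-isFilter (¬ a)) f∈F)) ,
    λ a∈u → ul-¬ u a∈u (⊆u (⊻-upperʳ isF (lift ≤-refl)))
    where
    ⊥∉ : ⊥ ∉ (F ⊻ (↑ (¬ a)))
    ⊥∉ (f , g , f∈F , lift ¬a≤g , lift f∧g≤⊥) = a∉F (filter-≤ isF f∈F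
      (disjoint⇒≤ (∨-complementˡ a) (≤-trans (∧-mono ≤-refl ¬a≤g) f∧g≤⊥)))

  -- From subalgebras to C-equivalences

  -- One inclusion suffices because `B` is closed under complements: if `b` is not in `u`, then
  -- `¬ b` passes from `u` to `v`.
  agree : ∀ B {u v} → (∀ {b} → b ∈ domain B → b ∈ set u → b ∈ set v) → E[_] 𝔸 B u v
  agree B {u} {v} u⊆v =
    (λ (b∈u , b∈B) → u⊆v b∈B b∈u , b∈B) ,
    (λ (b∈v , b∈B) → dne (λ b∉u → ul-¬ v b∈v (u⊆v (B.¬-closed b∈B) (ul-complete u b∉u))) , b∈B)
    where module B = IsSubalgebra (isSubalgebra B)

  -- `G` and the elements of `z` in `B` generate a proper filter: if `f ∧ b ≤ ⊥` with `f` in `G` and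
  -- `b` in both `z` and `B`, then `¬ b` lies in `G` and in `B`, hence in `z`.
  extension-agreeing : ∀ B {G z} → IsFilter 𝔸 G → (∀ {b} → b ∈ domain B → b ∈ G → b ∈ set z) →
                       Σ[ w ∈ Ul 𝔸 ] G ⊆ set w × E[_] 𝔸 B z w
  extension-agreeing B {G} {z} isG G∩B⊆z =
    let w , ⊆w = ultrafilter-extension (⊻-isFilter isG isz↾B) ⊥∉ in
    w , (λ g∈G → ⊆w (⊻-upperˡ isz↾B g∈G)) ,
    agree B {z} {w} (λ b∈B b∈z → ⊆w (⊻-upperʳ isG (_ , b∈z , b∈B , lift ≤-refl)))
    where
    module B = IsSubalgebra (isSubalgebra B)
    isz↾B = ↾-isFilter (ul-filter z) B

    ⊥∉ : ⊥ ∉ (G ⊻ (set z ↾ B))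
    ⊥∉ (f , g , f∈G , (b , b∈z , b∈B , lift b≤g) , lift f∧g≤⊥) =
      ul-¬ z b∈z (G∩B⊆z (B.¬-closed b∈B) (filter-≤ isG f∈G
        (disjoint⇒≤ (∨-complementʳ b) (≤-trans (∧-mono ≤-refl b≤g) f∧g≤⊥))))

  -- For meets, left antitonicity replaces both antecedents by their meet, after which `⇝-∧` joins
  -- the two conditionals.
  D-isFilter : ∀ u {F} → IsFilter 𝔸 F → IsFilter 𝔸 (D 𝔸 u F)
  D-isFilter u isF = record
    { ⊤-mem    = ⊤ , filter-⊤ isF , ≈-mem isU (≈-sym (⇝-⊤ ⊤)) (filter-⊤ isU)
    ; ∧-closed = λ (a , a∈F , p) (a′ , a′∈F , p′) →
        a ∧ a′ , filter-∧ isF a∈F a′∈F ,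
        ≈-mem isU (⇝-∧ _ _ _) (filter-∧ isU
          (filter-≤ isU p (⇝-antitoneˡ (x∧y≤x _ _))) (filter-≤ isU p′ (⇝-antitoneˡ (x∧y≤y _ _))))
    ; ≤-closed = λ (a , a∈F , p) q → a , a∈F , filter-≤ isU p (⇝-monoʳ q)
    }
    where isU = ul-filter u

  clopen : Carrier → Pred (Ul 𝔸) s
  clopen a u = a ∈ set u

  clopen≐φ↑ : ∀ a → clopen a ≐ φ 𝔸 (↑ a)
  clopen≐φ↑ a = (λ {u} a∈u (lift a≤x) → filter-≤ (ul-filter u) a∈u a≤x) , (λ ↑a⊆u → ↑a⊆u (lift ≤-refl))

  clopen-isClopen : ∀ a → IsClopen 𝔸 (clopen a)
  clopen-isClopen a =
    (↑ a , ↑-isFilter a , clopen≐φ↑ a) ,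
    (↑ (¬ a) , ↑-isFilter (¬ a) ,
      (λ {u} a∉u → proj₁ (clopen≐φ↑ (¬ a)) {u} (ul-complete u a∉u)) ,
      (λ {u} ↑¬a⊆u a∈u → ul-¬ u a∈u (↑¬a⊆u (lift ≤-refl))))

  E-isCEquivalence : ∀ B → IsCEquivalence 𝔸 (E[_] 𝔸 B)
  E-isCEquivalence B = record
    { isBooleanEquivalence = record
      { isEquivalence = record
        { refl  = id , id
        ; sym   = λ (p , q) → q , p
        ; trans = λ (p , q) (p′ , q′) → p′ ∘ p , q ∘ q′
        }
      ; reflexive = λ (p , q) → (λ (a∈u , a∈B) → p a∈u , a∈B) , (λ (a∈v , a∈B) → q a∈v , a∈B)
      ; separated = λ {x} {y} → separated {x} {y}
      }
    ; back = λ {x} {y} {x′} → back {x} {y} {x′}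
    }
    where
    module B = IsSubalgebra (isSubalgebra B)

    separated : ∀ {x y} → Not (E[_] 𝔸 B x y) →
                Σ[ U ∈ Pred (Ul 𝔸) s ] IsClopen 𝔸 U × _IsSaturatedUnder_ 𝔸 U (E[_] 𝔸 B) × x ∈ U × y ∉ U
    separated {x} {y} ¬E with em {P = ∃[ b ] b ∈ domain B × b ∈ set x × b ∉ set y}
    ... | yes (b , b∈B , b∈x , b∉y) =
      clopen b , clopen-isClopen b , (λ (p , _) b∈u → proj₁ (p (b∈u , b∈B))) , b∈x , b∉y
    ... | no ∄ = contradiction (agree B {x} {y} λ b∈B b∈x → dne λ b∉y → ∄ (_ , b∈B , b∈x , b∉y)) ¬E

    back : ∀ {x y x′} {Y : Pred (Ul 𝔸) s} → E[_] 𝔸 B x y → IsClosed 𝔸 Y → T 𝔸 x Y x′ →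
           Σ[ y′ ∈ Ul 𝔸 ] E[_] 𝔸 B x′ y′ ×
             (Σ[ C ∈ Pred (Ul 𝔸) s ] IsClosed 𝔸 C × T 𝔸 y C y′ × Dominated 𝔸 (E[_] 𝔸 B) C Y)
    back {x} {y} {x′} {Y} (_ , y⊆x) _ (F , isF , Y≐φF , DxF⊆x′) =
      let y′ , Dy⊆y′ , x′Ey′ = extension-agreeing B {z = x′} (D-isFilter y isF↾B) DyF∩B⊆x′
      in y′ , x′Ey′ , φ 𝔸 (F ↾ B) , (F ↾ B , isF↾B , id , id) ,
         (F ↾ B , isF↾B , (id , id) , Dy⊆y′) , λ {z} → dominated {z}
      where
      isF↾B = ↾-isFilter isF B

      DyF∩B⊆x′ : ∀ {d} → d ∈ domain B → d ∈ D 𝔸 y (F ↾ B) → d ∈ set x′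
      DyF∩B⊆x′ d∈B (a , (b , b∈F , b∈B , lift b≤a) , a⇝d∈y) =
        -- Strengthening the antecedent from `a` to `b` puts the conditional inside `B`, where `x`
        -- and `y` agree.
        DxF⊆x′ (b , b∈F , proj₁ (y⊆x (filter-≤ (ul-filter y) a⇝d∈y (⇝-antitoneˡ b≤a) , B.⇝-closed b∈B d∈B)))

      dominated : Dominated 𝔸 (E[_] 𝔸 B) (φ 𝔸 (F ↾ B)) Y
      dominated {z} F↾B⊆z =
        let w , F⊆w , zEw = extension-agreeing B {z = z} isF
              (λ b∈B b∈F → F↾B⊆z (_ , b∈F , b∈B , lift ≤-refl))
        in w , proj₂ Y≐φF F⊆w , zEw

  E-antitone : ∀ {B C} → domain B ⊆ domain C → ∀ {u v} → E[_] 𝔸 C u v → E[_] 𝔸 B u v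
  E-antitone {B} B⊆C {u} {v} (p , _) = agree B {u} {v} λ b∈B b∈u → proj₁ (p (b∈u , B⊆C b∈B))

  -- If `a` in `B` were outside `C`, some `v` would omit `a` but contain every element of `C` above
  -- `a`. An ultrafilter `u` containing `a` and agreeing with `v` on `C` then contradicts the
  -- inclusion of relations.
  E-reflects : ∀ {B C} → (∀ {u v} → E[_] 𝔸 C u v → E[_] 𝔸 B u v) → domain B ⊆ domain C
  E-reflects {B} {C} EC⊆EB {a} a∈B = dne λ a∉C →
    let v , ⊆v , a∉v = ultrafilter-separation (↾-isFilter (↑-isFilter a) C)
          (λ (b , lift a≤b , b∈C , lift b≤a) → a∉C (C.≈-closed (antisym b≤a a≤b) b∈C))
        u , ↑a⊆u , vEu = extension-agreeing C {z = v} (↑-isFilter a)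
          (λ b∈C a≤b → ⊆v (_ , a≤b , b∈C , lift ≤-refl))
    in a∉v (proj₁ (proj₂ (EC⊆EB {v} {u} vEu) (↑a⊆u (lift ≤-refl) , a∈B)))
    where module C = IsSubalgebra (isSubalgebra C)

  -- From C-equivalences to subalgebras

  φ-⊆-clopen : ∀ {F a} → IsFilter 𝔸 F → φ 𝔸 F ⊆ clopen a → a ∈ F
  φ-⊆-clopen isF φF⊆a = dne λ a∉F →
    let u , F⊆u , a∉u = ultrafilter-separation isF a∉F in a∉u (φF⊆a {u} F⊆u)

  -- Compactness in filter form: no ultrafilter extends both `F` and `G`, so some `f` in `F` and `g`
  -- in `G` are disjoint, and `f` defines `U`.
  isClopen⇒clopen : ∀ {U} → IsClopen 𝔸 U → ∃[ a ] U ≐ clopen a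
  isClopen⇒clopen {U} ((F , isF , U≐φF) , (G , isG , ∁U≐φG)) =
    let f , g , f∈F , g∈G , lift f∧g≤⊥ = ⊥∈F⊻G in
    f , (λ u∈U → proj₁ U≐φF u∈U f∈F) ,
    λ {u} f∈u → dne λ u∉U → ul-consistent u f∈u (proj₁ ∁U≐φG u∉U g∈G) f∧g≤⊥
    where
    ⊥∈F⊻G : ⊥ ∈ (F ⊻ G)
    ⊥∈F⊻G = dne λ ⊥∉ →
      let u , ⊆u = ultrafilter-extension (⊻-isFilter isF isG) ⊥∉ in
      proj₂ ∁U≐φG {u} (λ g∈G → ⊆u (⊻-upperʳ isF g∈G))
        (proj₂ U≐φF (λ f∈F → ⊆u (⊻-upperˡ isG f∈F)))

  module _ (E : CEquivalence 𝔸) where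

    private
      module E = IsCEquivalence (isCEquivalence E)
      module EB = IsBooleanEquivalence E.isBooleanEquivalence
      module EE = IsEquivalence EB.isEquivalence

    Saturated : Carrier → Set _
    Saturated a = _IsSaturatedUnder_ 𝔸 (clopen a) (rel E)

    saturated-¬ : ∀ {a} → Saturated a → Saturated (¬ a)
    saturated-¬ sat {u} {v} uEv ¬a∈u = ul-complete v λ a∈v → ul-¬ u (sat (EE.sym uEv) a∈v) ¬a∈u

    -- If `a ⇝ b` held at `u` but not at `v`, some `v′` without `b` would be reached from `v`
    -- through `φ (↑ a)`. The back condition moves this to a related `u′` reached from `u` through a
    -- set `C`, and `b` must hold at `u′`.
    saturated-⇝ : ∀ {a b} → Saturated a → Saturated b → Saturated (a ⇝ b)
    saturated-⇝ {a} {b} satA satB {u} {v} uEv a⇝b∈u = dne λ a⇝b∉v →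
      let v′ , D⊆v′ , b∉v′ = ultrafilter-separation (D-isFilter v (↑-isFilter a))
            (λ (d , lift a≤d , d⇝b∈v) → a⇝b∉v (filter-≤ (ul-filter v) d⇝b∈v (⇝-antitoneˡ a≤d)))
          u′ , v′Eu′ , C , _ , (G , isG , C≐φG , DuG⊆u′) , C≼ =
            E.back {x′ = v′} (EE.sym uEv) (↑ a , ↑-isFilter a , id , id)
              (↑ a , ↑-isFilter a , (id , id) , D⊆v′)
          -- Each point of `C` is related to one containing `a`, so saturation gives it `a` as well;
          -- hence `a` lies in `G` and `b` in `D u G`.
          φG⊆a : φ 𝔸 G ⊆ clopen a
          φG⊆a {z} G⊆z = let w , ↑a⊆w , zEw = C≼ {z} (proj₂ C≐φG G⊆z)
                         in satA (EE.sym zEw) (↑a⊆w (lift ≤-refl))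
      in b∉v′ (satB (EE.sym v′Eu′) (DuG⊆u′ (a , φ-⊆-clopen isG (λ {z} → φG⊆a {z}) , a⇝b∈u)))

    SaturatedElement : Pred Carrier s
    SaturatedElement a = Resize s (Saturated a)

    saturated⁺ : ∀ {a} → Saturated a → a ∈ SaturatedElement
    saturated⁺ {a} = resize {P = Saturated a}

    saturated⁻ : ∀ {a} → a ∈ SaturatedElement → Saturated a
    saturated⁻ {a} = unresize {P = Saturated a}

    saturatedSubalgebra : Subalgebra 𝔸
    saturatedSubalgebra = record
      { domain       = SaturatedElement
      ; isSubalgebra = record
        { ≈-closed = λ a≈b p → saturated⁺ λ {u} {v} uEv b∈u →
            ≈-mem (ul-filter v) a≈b (saturated⁻ p uEv (≈-mem (ul-filter u) (≈-sym a≈b) b∈u))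
        ; ⊤-mem    = saturated⁺ λ {u} {v} _ _ → filter-⊤ (ul-filter v)
        ; ⊥-mem    = saturated⁺ λ {u} {_} _ ⊥∈u →
            contradiction ⊥∈u (IsUltrafilter.proper (isUltrafilter u))
        ; ¬-closed = λ p → saturated⁺ (saturated-¬ (saturated⁻ p))
        ; ∧-closed = λ p q → saturated⁺ λ {u} {v} uEv a∧b∈u → filter-∧ (ul-filter v)
            (saturated⁻ p uEv (filter-≤ (ul-filter u) a∧b∈u (x∧y≤x _ _)))
            (saturated⁻ q uEv (filter-≤ (ul-filter u) a∧b∈u (x∧y≤y _ _)))
        ; ∨-closed = λ p q → saturated⁺ λ {u} {v} uEv a∨b∈u → dne λ a∨b∉v → ul-∨ u a∨b∈u
            ( (λ a∈u → a∨b∉v (filter-≤ (ul-filter v) (saturated⁻ p uEv a∈u) (x≤x∨y _ _)))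
            , (λ b∈u → a∨b∉v (filter-≤ (ul-filter v) (saturated⁻ q uEv b∈u) (y≤x∨y _ _))))
        ; ⇝-closed = λ p q → saturated⁺ (saturated-⇝ (saturated⁻ p) (saturated⁻ q))
        }
      }

    rel⇒E-saturated : ∀ {u v} → rel E u v → E[_] 𝔸 saturatedSubalgebra u v
    rel⇒E-saturated {u} {v} uEv = agree saturatedSubalgebra {u} {v} λ p a∈u → saturated⁻ p uEv a∈u

    -- The Boolean condition separates unrelated points by a saturated clopen set, which is
    -- `clopen a` for an element `a` of the saturated subalgebra.
    E-saturated⇒rel : ∀ {u v} → E[_] 𝔸 saturatedSubalgebra u v → rel E u v
    E-saturated⇒rel {u} {v} (p , _) = dne λ ¬uEv →
      let U , isClopen , sat , u∈U , v∉U = EB.separated ¬uEv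
          a , U⊆a , a⊆U = isClopen⇒clopen isClopen
          satA : Saturated a
          satA xEy a∈x = U⊆a (sat xEy (a⊆U a∈x))
      in v∉U (a⊆U (proj₁ (p (U⊆a u∈U , saturated⁺ satA))))

  -- The lattice of C-equivalences and the dual isomorphism.

  toCEquivalence : Subalgebra 𝔸 → CEquivalence 𝔸
  toCEquivalence B = mkCEquivalence (E[_] 𝔸 B) (E-isCEquivalence B)

  module Sub = Order.Lattice (subalgebraLattice 𝔸)
  module CEq = Poset (cEquivalencePoset 𝔸)

  toCEquivalence-cong : ∀ {B C} → B Sub.≈ C → toCEquivalence B CEq.≈ toCEquivalence C
  toCEquivalence-cong {B} {C} (B⊆C , C⊆B) =
    (λ {u} {v} → E-antitone {C} {B} C⊆B {u} {v}) , (λ {u} {v} → E-antitone {B} {C} B⊆C {u} {v})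

  toCEquivalence-injective : ∀ {B C} → toCEquivalence B CEq.≈ toCEquivalence C → B Sub.≈ C
  toCEquivalence-injective {B} {C} (p , q) =
    E-reflects {B} {C} (λ {u} {v} → q {u} {v}) , E-reflects {C} {B} (λ {u} {v} → p {u} {v})

  CEq-≤⇒⊇ : ∀ {E E′} → E CEq.≤ E′ → domain (saturatedSubalgebra E′) ⊆ domain (saturatedSubalgebra E)
  CEq-≤⇒⊇ {E} {E′} E≤E′ p = saturated⁺ E λ uEv → saturated⁻ E′ p (E≤E′ uEv)

  -- Together with `E-below`, this reduces bounds among C-equivalences to reversed inclusions of
  -- subalgebras.
  below-E : ∀ E {B} → domain B ⊆ domain (saturatedSubalgebra E) → E CEq.≤ toCEquivalence B
  below-E E {B} B⊆ {u} {v} uEv =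
    E-antitone {B} {saturatedSubalgebra E} B⊆ {u} {v} (rel⇒E-saturated E uEv)

  E-below : ∀ E {B} → domain (saturatedSubalgebra E) ⊆ domain B → toCEquivalence B CEq.≤ E
  E-below E {B} ⊆B {u} {v} uEv =
    E-saturated⇒rel E (E-antitone {saturatedSubalgebra E} {B} ⊆B {u} {v} uEv)

  -- Both subalgebras induce the same equivalence, so injectivity identifies them.
  saturated-E : ∀ B → saturatedSubalgebra (toCEquivalence B) Sub.≈ B
  saturated-E B = toCEquivalence-injective {saturatedSubalgebra (toCEquivalence B)} {B}
    ( (λ {u} {v} → E-saturated⇒rel (toCEquivalence B) {u} {v})
    , (λ {u} {v} → rel⇒E-saturated (toCEquivalence B) {u} {v}))

  latticeStructure : LatticeStructure (cEquivalencePoset 𝔸)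
  latticeStructure = record
    { _∨_       = λ E E′ → toCEquivalence (saturatedSubalgebra E Sub.∧ saturatedSubalgebra E′)
    ; _∧_       = λ E E′ → toCEquivalence (saturatedSubalgebra E Sub.∨ saturatedSubalgebra E′)
    ; isLattice = record
      { isPartialOrder = CEq.isPartialOrder
      ; supremum       = λ E E′ → let B = saturatedSubalgebra E; B′ = saturatedSubalgebra E′ in
          below-E E {B Sub.∧ B′} (Sub.x∧y≤x B B′) ,
          below-E E′ {B Sub.∧ B′} (Sub.x∧y≤y B B′) ,
          λ E″ E≤E″ E′≤E″ → E-below E″ {B Sub.∧ B′}
            (Sub.∧-greatest {saturatedSubalgebra E″} {B} {B′}
              (CEq-≤⇒⊇ {E} {E″} E≤E″) (CEq-≤⇒⊇ {E′} {E″} E′≤E″))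
      ; infimum        = λ E E′ → let B = saturatedSubalgebra E; B′ = saturatedSubalgebra E′ in
          E-below E {B Sub.∨ B′} (Sub.x≤x∨y B B′) ,
          E-below E′ {B Sub.∨ B′} (Sub.y≤x∨y B B′) ,
          λ E″ E″≤E E″≤E′ → below-E E″ {B Sub.∨ B′}
            (Sub.∨-least {B} {B′} {saturatedSubalgebra E″}
              (CEq-≤⇒⊇ {E″} {E} E″≤E) (CEq-≤⇒⊇ {E″} {E′} E″≤E′))
      }
    }

  isDualLatticeIsomorphism :
    IsDualLatticeIsomorphism (subalgebraLattice 𝔸) (LatticeStructure.lattice latticeStructure) toCEquivalence
  isDualLatticeIsomorphism = record
    { isLatticeMonomorphism = record
      { isLatticeHomomorphism = record
        { isRelHomomorphism = record { cong = λ {B} {C} → toCEquivalence-cong {B} {C} }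
        -- Joins and meets of C-equivalences are computed on saturated subalgebras, so `B` and `C`
        -- are first replaced by `sat B` and `sat C`.
        ; ∧-homo            = λ B C → toCEquivalence-cong {B Sub.∧ C} {sat B Sub.∧ sat C}
            (Alg.∧-cong {B} {sat B} {C} {sat C} (≈-sat B) (≈-sat C))
        ; ∨-homo            = λ B C → toCEquivalence-cong {B Sub.∨ C} {sat B Sub.∨ sat C}
            (Alg.∨-cong {B} {sat B} {C} {sat C} (≈-sat B) (≈-sat C))
        }
      ; injective = λ {B} {C} → toCEquivalence-injective {B} {C}
      }
    -- Every `B` equal to the saturated subalgebra has to be sent to `E`; the two inclusions give
    -- the two directions.
    ; surjective = λ E → saturatedSubalgebra E , λ {B} (B⊆ , ⊆B) →
        (λ {u} {v} → E-below E {B} ⊆B {u} {v}) , (λ {u} {v} → below-E E {B} B⊆ {u} {v})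
    }
    where
    module Alg = AlgLattice.Lattice (OrderLatticeProperties.algLattice (subalgebraLattice 𝔸))
    sat : Subalgebra 𝔸 → Subalgebra 𝔸
    sat B = saturatedSubalgebra (toCEquivalence B)

    ≈-sat : ∀ B → B Sub.≈ sat B
    ≈-sat B = Sub.Eq.sym {sat B} {B} (saturated-E B)

theorem7p6 : (∀ {p} → ExcludedMiddle p) → (∀ {a b} → Extensionality a b) →
    ∀ {c ℓ} (𝔸 : ConditionalAlgebra c ℓ) →
    Σ[ isC ∈ (∀ (B : Subalgebra 𝔸) → IsCEquivalence 𝔸 (E[_] 𝔸 B)) ]
    Σ[ S ∈ LatticeStructure (cEquivalencePoset 𝔸) ]
      IsDualLatticeIsomorphism (subalgebraLattice 𝔸) (LatticeStructure.lattice S)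
        (λ B → mkCEquivalence (E[_] 𝔸 B) (isC B))
theorem7p6 em ext 𝔸 = E-isCEquivalence , latticeStructure , isDualLatticeIsomorphism
  where open Duality em ext 𝔸
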